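{- For all positive integers $k,n$, $$\sum_{i=0}^{n}M_{2i+1}^{(k)}=\frac{2^kM_{n+1}^{(2k)}-n-1}{M_k} .$$
   Context: The Mersenne numbers $\{M_n\}_{n\ge 0}$ are defined by $M_0=0$, $M_1=1$, $M_{n+2}=3M_{n+1}-2M_n$, i.e. $M_n=2^n-1$. For a positive integer $k$, the higher order Mersenne numbers are $M_n^{(k)}=M_{kn}/M_k$ for $n=0,1,2,\dots$ (so $M_n^{(2k)}=M_{2kn}/M_{2k}$). -}

module Defs where

open import Data.Nat.Base as ℕ using (ℕ; zero; suc; NonZero)
import Data.Nat.Properties as ℕ
open import Data.Integer.Base as ℤ using (ℤ; +_; -[1+_]; +[1+_]; _*_; _-_)
import Data.Integer.Properties as ℤ
open import Data.Integer.Tactic.RingSolver using (solve-∀)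
open import Data.Rational.Base as ℚ using (ℚ; _/_; _÷_)
import Data.Rational.Properties as ℚ
open import Relation.Binary.PropositionalEquality

M : ℕ → ℤ
M 0             = + 0
M 1             = + 1
M (suc (suc n)) = + 3 * M (suc n) - + 2 * M n

1+M≡2^ : ∀ n → + 1 ℤ.+ M n ≡ + (2 ℕ.^ n)
1+M≡2^ 0             = refl
1+M≡2^ 1             = refl
1+M≡2^ (suc (suc n)) = begin
  + 1 ℤ.+ (+ 3 * M (suc n) - + 2 * M n)
    ≡⟨ rearrange (M (suc n)) (M n) ⟩
  + 3 * (+ 1 ℤ.+ M (suc n)) - + 2 * (+ 1 ℤ.+ M n)
    ≡⟨ cong₂ (λ x y → + 3 * x - + 2 * y) (1+M≡2^ (suc n)) (1+M≡2^ n) ⟩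
  + 3 * + (2 ℕ.* 2 ℕ.^ n) - + 2 * + (2 ℕ.^ n)
    ≡⟨ cong (λ x → + 3 * x - + 2 * + (2 ℕ.^ n)) (ℤ.pos-* 2 (2 ℕ.^ n)) ⟩
  + 3 * (+ 2 * + (2 ℕ.^ n)) - + 2 * + (2 ℕ.^ n)
    ≡⟨ collect (+ (2 ℕ.^ n)) ⟩
  + 2 * (+ 2 * + (2 ℕ.^ n))
    ≡⟨ cong (+ 2 *_) (ℤ.pos-* 2 (2 ℕ.^ n)) ⟨
  + 2 * + (2 ℕ.* 2 ℕ.^ n)
    ≡⟨ ℤ.pos-* 2 (2 ℕ.* 2 ℕ.^ n) ⟨
  + (2 ℕ.^ suc (suc n)) ∎
  where
  open ≡-Reasoning
  rearrange : ∀ a b → + 1 ℤ.+ (+ 3 * a - + 2 * b) ≡ + 3 * (+ 1 ℤ.+ a) - + 2 * (+ 1 ℤ.+ b)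
  rearrange = solve-∀
  collect : ∀ x → + 3 * (+ 2 * x) - + 2 * x ≡ + 2 * (+ 2 * x)
  collect = solve-∀

M-nonZero : ∀ k .{{_ : NonZero k}} → ℤ.NonZero (M k)
M-nonZero (suc k) = ℤ.≢-nonZero {M (suc k)} λ M≡0 →
  ℕ.even≢odd (2 ℕ.^ k) 0 (sym (ℤ.+-injective
    (trans (cong (ℤ._+_ (+ 1)) (sym M≡0)) (1+M≡2^ (suc k)))))

/1-nonZero : ∀ z .{{_ : ℤ.NonZero z}} → ℚ.NonZero (z / 1)
/1-nonZero +[1+ n ] = ℚ.pos⇒nonZero (+[1+ n ] / 1) {{ℚ.normalize-pos (suc n) 1}}
/1-nonZero -[1+ n ] = ℚ.neg⇒nonZero (-[1+ n ] / 1)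
  {{ℚ.neg-pos {ℚ.normalize (suc n) 1} (ℚ.normalize-pos (suc n) 1)}}

Mℚ : ℕ → ℚ
Mℚ n = M n / 1

Mℚ-nonZero : ∀ k .{{_ : NonZero k}} → ℚ.NonZero (Mℚ k)
Mℚ-nonZero k = /1-nonZero (M k) {{M-nonZero k}}

-- M^[ k ] n is M_n^{(k)}. It is always an integer, but is defined as a quotient in ℚ.
M^[_]_ : (k : ℕ) .{{_ : NonZero k}} → ℕ → ℚ
M^[ k ] n = _÷_ (Mℚ (k ℕ.* n)) (Mℚ k) {{Mℚ-nonZero k}}

{-# OPTIONS --safe #-}

-- Put S n = (2^k M^(2k)_n − n) / M_k. Since M_{m+n} = M_n + 2^n M_m, one has
-- M^(k)_{n+1} = M^(k)_n + 2^{kn}, so S (n + 1) − S n = (2^k 2^{2kn} − 1) / M_k = M^(k)_{2n+1},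
-- and the sum telescopes to S (n + 1) − S 0 = S (n + 1).

module Submission where

open import Defs
open import Data.Nat.Base as ℕ using (ℕ; zero; suc; NonZero)
open import Data.Nat.Properties using (m*n≢0)
import Data.Nat.Properties as ℕ
import Data.Nat.Tactic.RingSolver as ℕ
open import Data.Integer.Base as ℤ using (ℤ; +_)
import Data.Integer.Properties as ℤ
import Data.Integer.Tactic.RingSolver as ℤ
open import Data.Fin.Base using (toℕ)
open import Data.Rational.Base using (ℚ; _/_; _+_; _*_; _-_; _÷_; 1/_; 0ℚ; 1ℚ; toℚᵘ)
import Data.Rational.Properties as ℚ
open import Data.Rational.Properties using (+-0-commutativeMonoid)
open import Data.Rational.Solver using (module +-*-Solver)
open import Data.Rational.Unnormalised.Base as ℚᵘ using (mkℚᵘ; *≡*; _≃_)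
import Data.Rational.Unnormalised.Properties as ℚᵘ
open import Algebra.Properties.CommutativeMonoid.Sum +-0-commutativeMonoid
  using (sum-syntax; sum⁺-syntax)
open import Relation.Binary.PropositionalEquality

open +-*-Solver using (solve; _:=_; _:+_; _:*_; _:-_)

-- `i / 1` is normalised through a gcd and does not compute for a variable `i`. Its unnormalised
-- counterpart is the bare pair `mkℚᵘ i 0`, on which arithmetic does compute, so the homomorphism
-- laws below are checked there.
toℚᵘ-/1 : ∀ i → toℚᵘ (i / 1) ≃ mkℚᵘ i 0
toℚᵘ-/1 i = ℚ.toℚᵘ-fromℚᵘ (mkℚᵘ i 0)

/1-homo-+ : ∀ i j → (i ℤ.+ j) / 1 ≡ i / 1 + j / 1
/1-homo-+ i j = ℚ.toℚᵘ-injective (begin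
  toℚᵘ ((i ℤ.+ j) / 1)              ≈⟨ toℚᵘ-/1 (i ℤ.+ j) ⟩
  mkℚᵘ (i ℤ.+ j) 0                  ≈⟨ *≡* (cross i j) ⟩
  mkℚᵘ i 0 ℚᵘ.+ mkℚᵘ j 0            ≈⟨ ℚᵘ.+-cong (toℚᵘ-/1 i) (toℚᵘ-/1 j) ⟨
  toℚᵘ (i / 1) ℚᵘ.+ toℚᵘ (j / 1)    ≈⟨ ℚ.toℚᵘ-homo-+ (i / 1) (j / 1) ⟨
  toℚᵘ (i / 1 + j / 1)              ∎)
  where
  open import Relation.Binary.Reasoning.Setoid ℚᵘ.≃-setoid
  cross : ∀ i j → (i ℤ.+ j) ℤ.* + 1 ≡ (i ℤ.* + 1 ℤ.+ j ℤ.* + 1) ℤ.* + 1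
  cross = ℤ.solve-∀

/1-homo-* : ∀ i j → (i ℤ.* j) / 1 ≡ (i / 1) * (j / 1)
/1-homo-* i j = ℚ.toℚᵘ-injective (begin
  toℚᵘ ((i ℤ.* j) / 1)              ≈⟨ toℚᵘ-/1 (i ℤ.* j) ⟩
  -- `mkℚᵘ (i ℤ.* j) 0` is this product by computation, so unlike for sums no cross-multiplication
  -- is needed.
  mkℚᵘ i 0 ℚᵘ.* mkℚᵘ j 0            ≈⟨ ℚᵘ.*-cong (toℚᵘ-/1 i) (toℚᵘ-/1 j) ⟨
  toℚᵘ (i / 1) ℚᵘ.* toℚᵘ (j / 1)    ≈⟨ ℚ.toℚᵘ-homo-* (i / 1) (j / 1) ⟨
  toℚᵘ ((i / 1) * (j / 1))          ∎)
  where open import Relation.Binary.Reasoning.Setoid ℚᵘ.≃-setoid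

open ≡-Reasoning

2^ℚ : ℕ → ℚ
2^ℚ n = + (2 ℕ.^ n) / 1

2^ℚ-+ : ∀ m n → 2^ℚ (m ℕ.+ n) ≡ 2^ℚ m * 2^ℚ n
2^ℚ-+ m n = begin
  + (2 ℕ.^ (m ℕ.+ n)) / 1               ≡⟨ cong (λ x → + x / 1) (ℕ.^-distribˡ-+-* 2 m n) ⟩
  + (2 ℕ.^ m ℕ.* 2 ℕ.^ n) / 1           ≡⟨ cong (_/ 1) (ℤ.pos-* (2 ℕ.^ m) (2 ℕ.^ n)) ⟩
  (+ (2 ℕ.^ m) ℤ.* + (2 ℕ.^ n)) / 1     ≡⟨ /1-homo-* (+ (2 ℕ.^ m)) (+ (2 ℕ.^ n)) ⟩
  2^ℚ m * 2^ℚ n                         ∎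

1+Mℚ≡2^ℚ : ∀ n → 1ℚ + Mℚ n ≡ 2^ℚ n
1+Mℚ≡2^ℚ n = trans (sym (/1-homo-+ (+ 1) (M n))) (cong (_/ 1) (1+M≡2^ n))

Mℚ≡2^ℚ-1 : ∀ n → Mℚ n ≡ 2^ℚ n - 1ℚ
Mℚ≡2^ℚ-1 n = begin
  -- `1ℚ` is passed to the solver as an ordinary variable `u`: the identity holds for every `u`.
  Mℚ n                ≡⟨ solve 2 (λ u x → x := u :+ x :- u) refl 1ℚ (Mℚ n) ⟩
  1ℚ + Mℚ n - 1ℚ      ≡⟨ cong (_- 1ℚ) (1+Mℚ≡2^ℚ n) ⟩
  2^ℚ n - 1ℚ          ∎

-- In 2^m 2^n - 1, write 2^m as 1 + M_m and split off 2^n - 1 = M_n.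
Mℚ-+ : ∀ m n → Mℚ (m ℕ.+ n) ≡ Mℚ n + 2^ℚ n * Mℚ m
Mℚ-+ m n = begin
  Mℚ (m ℕ.+ n)                              ≡⟨ Mℚ≡2^ℚ-1 (m ℕ.+ n) ⟩
  2^ℚ (m ℕ.+ n) - 1ℚ                        ≡⟨ cong (_- 1ℚ) (2^ℚ-+ m n) ⟩
  2^ℚ m * 2^ℚ n - 1ℚ                        ≡⟨ cong (λ x → x * 2^ℚ n - 1ℚ) (1+Mℚ≡2^ℚ m) ⟨
  (1ℚ + Mℚ m) * 2^ℚ n - 1ℚ                  ≡⟨ cong (_- 1ℚ) (ℚ.*-distribʳ-+ (2^ℚ n) 1ℚ (Mℚ m)) ⟩
  1ℚ * 2^ℚ n + Mℚ m * 2^ℚ n - 1ℚ            ≡⟨ cong (λ x → x + Mℚ m * 2^ℚ n - 1ℚ) (ℚ.*-identityˡ (2^ℚ n)) ⟩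
  2^ℚ n + Mℚ m * 2^ℚ n - 1ℚ                 ≡⟨ solve 3 (λ u x p → p :+ x :* p :- u := (p :- u) :+ p :* x) refl 1ℚ (Mℚ m) (2^ℚ n) ⟩
  2^ℚ n - 1ℚ + 2^ℚ n * Mℚ m                 ≡⟨ cong (_+ 2^ℚ n * Mℚ m) (Mℚ≡2^ℚ-1 n) ⟨
  Mℚ n + 2^ℚ n * Mℚ m                       ∎

M^-zero : ∀ k .{{_ : NonZero k}} → M^[ k ] 0 ≡ 0ℚ
M^-zero k = begin
  Mℚ (k ℕ.* 0) * 1/Mk   ≡⟨ cong (λ x → Mℚ x * 1/Mk) (ℕ.*-zeroʳ k) ⟩
  0ℚ * 1/Mk             ≡⟨ ℚ.*-zeroˡ 1/Mk ⟩
  0ℚ                    ∎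
  where
  1/Mk : ℚ
  1/Mk = 1/_ (Mℚ k) {{Mℚ-nonZero k}}

-- The addition law for k + kn leaves M_k as a factor of the second term, where it cancels against
-- the divisor. Thus M^(k)_n is the geometric sum 1 + 2^k + ... + 2^(k(n-1)).
M^-suc : ∀ k n .{{_ : NonZero k}} → M^[ k ] (suc n) ≡ M^[ k ] n + 2^ℚ (k ℕ.* n)
M^-suc k n = begin
  Mℚ (k ℕ.* suc n) * 1/Mk                         ≡⟨ cong (λ x → Mℚ x * 1/Mk) (ℕ.*-suc k n) ⟩
  Mℚ (k ℕ.+ k ℕ.* n) * 1/Mk                       ≡⟨ cong (_* 1/Mk) (Mℚ-+ k (k ℕ.* n)) ⟩
  (Mkn + 2^kn * Mℚ k) * 1/Mk                      ≡⟨ solve 4 (λ x p m r → (x :+ p :* m) :* r := x :* r :+ p :* (m :* r)) refl Mkn 2^kn (Mℚ k) 1/Mk ⟩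
  Mkn * 1/Mk + 2^kn * (Mℚ k * 1/Mk)               ≡⟨ cong (λ x → Mkn * 1/Mk + 2^kn * x) (ℚ.*-inverseʳ (Mℚ k) {{Mℚ-nonZero k}}) ⟩
  Mkn * 1/Mk + 2^kn * 1ℚ                          ≡⟨ cong (_+_ (Mkn * 1/Mk)) (ℚ.*-identityʳ 2^kn) ⟩
  Mkn * 1/Mk + 2^kn                               ∎
  where
  1/Mk Mkn 2^kn : ℚ
  1/Mk = 1/_ (Mℚ k) {{Mℚ-nonZero k}}
  Mkn  = Mℚ (k ℕ.* n)
  2^kn = 2^ℚ (k ℕ.* n)

-- Splitting k(2n + 1) as k + 2kn exposes 2^(2kn), which is exactly the increment of M^(2k) at n
-- given by `M^-suc`.
Mℚ-odd-multiple : ∀ k n → Mℚ (k ℕ.* (2 ℕ.* n ℕ.+ 1)) ≡ 2^ℚ k * 2^ℚ (2 ℕ.* k ℕ.* n) - 1ℚ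
Mℚ-odd-multiple k n = begin
  Mℚ (k ℕ.* (2 ℕ.* n ℕ.+ 1))              ≡⟨ cong Mℚ (split k n) ⟩
  Mℚ (k ℕ.+ 2 ℕ.* k ℕ.* n)                ≡⟨ Mℚ≡2^ℚ-1 (k ℕ.+ 2 ℕ.* k ℕ.* n) ⟩
  2^ℚ (k ℕ.+ 2 ℕ.* k ℕ.* n) - 1ℚ          ≡⟨ cong (_- 1ℚ) (2^ℚ-+ k (2 ℕ.* k ℕ.* n)) ⟩
  2^ℚ k * 2^ℚ (2 ℕ.* k ℕ.* n) - 1ℚ        ∎
  where
  split : ∀ k n → k ℕ.* (2 ℕ.* n ℕ.+ 1) ≡ k ℕ.+ 2 ℕ.* k ℕ.* n
  split = ℕ.solve-∀

-- Keeping `S 0` on the left avoids subtraction. A sum over `Fin` unfolds at its first term, so the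
-- induction absorbs `f 0` into `S 0` and continues with `f` and `S` both shifted by one.
∑-telescope : (f S : ℕ → ℚ) → (∀ n → S (suc n) ≡ S n + f n) →
  ∀ n → S 0 + ∑[ i < n ] f (toℕ i) ≡ S n
∑-telescope f S step zero    = ℚ.+-identityʳ (S 0)
∑-telescope f S step (suc n) = begin
  S 0 + (f 0 + ∑[ i < n ] f (suc (toℕ i)))    ≡⟨ ℚ.+-assoc (S 0) (f 0) _ ⟨
  S 0 + f 0 + ∑[ i < n ] f (suc (toℕ i))      ≡⟨ cong (_+ ∑[ i < n ] f (suc (toℕ i))) (step 0) ⟨
  S 1 + ∑[ i < n ] f (suc (toℕ i))            ≡⟨ ∑-telescope (λ m → f (suc m)) (λ m → S (suc m)) (λ m → step (suc m)) n ⟩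
  S (suc n)                                   ∎

theorem2p19 : (k n : ℕ) .{{_ : NonZero k}} .{{_ : NonZero n}} →
    ∑[ i ≤ n ] (M^[ k ] (2 ℕ.* toℕ i ℕ.+ 1))
    ≡ _÷_
    ((+ (2 ℕ.^ k) / 1) * (M^[_]_ (2 ℕ.* k) {{m*n≢0 2 k}} (n ℕ.+ 1)) - (+ n / 1) - 1ℚ)
    (Mℚ k) {{Mℚ-nonZero k}}
theorem2p19 k n = begin
  ∑[ i ≤ n ] odd-term (toℕ i)             ≡⟨ ℚ.+-identityˡ _ ⟨
  0ℚ + ∑[ i ≤ n ] odd-term (toℕ i)        ≡⟨ cong (_+ ∑[ i ≤ n ] odd-term (toℕ i)) S-zero ⟨
  -- The range `i ≤ n` has `suc n` terms, so the telescope ends at `S (suc n)`.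
  S 0 + ∑[ i ≤ n ] odd-term (toℕ i)       ≡⟨ ∑-telescope odd-term S S-suc (suc n) ⟩
  (2^ℚ k * G (suc n) - + suc n / 1) * 1/Mk
    ≡⟨ cong₂ (λ m x → (2^ℚ k * G m - x) * 1/Mk) (ℕ.+-comm 1 n) (/1-homo-+ (+ 1) (+ n)) ⟩
  (2^ℚ k * G (n ℕ.+ 1) - (1ℚ + + n / 1)) * 1/Mk
    ≡⟨ cong (_* 1/Mk) (solve 3 (λ x u v → x :- (u :+ v) := x :- v :- u) refl (2^ℚ k * G (n ℕ.+ 1)) 1ℚ (+ n / 1)) ⟩
  (2^ℚ k * G (n ℕ.+ 1) - + n / 1 - 1ℚ) * 1/Mk ∎
  where
  1/Mk : ℚ
  1/Mk = 1/_ (Mℚ k) {{Mℚ-nonZero k}}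

  odd-term G S : ℕ → ℚ
  odd-term m = M^[ k ] (2 ℕ.* m ℕ.+ 1)
  G m = M^[_]_ (2 ℕ.* k) {{m*n≢0 2 k}} m
  S m = (2^ℚ k * G m - + m / 1) * 1/Mk

  S-zero : S 0 ≡ 0ℚ
  S-zero = begin
    (2^ℚ k * G 0 - 0ℚ) * 1/Mk     ≡⟨ cong (λ x → (2^ℚ k * x - 0ℚ) * 1/Mk) (M^-zero (2 ℕ.* k) {{m*n≢0 2 k}}) ⟩
    (2^ℚ k * 0ℚ - 0ℚ) * 1/Mk      ≡⟨ cong (λ x → (x - 0ℚ) * 1/Mk) (ℚ.*-zeroʳ (2^ℚ k)) ⟩
    0ℚ * 1/Mk                     ≡⟨ ℚ.*-zeroˡ 1/Mk ⟩
    0ℚ                            ∎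

  S-suc : ∀ m → S (suc m) ≡ S m + odd-term m
  S-suc m = begin
    (2^ℚ k * G (suc m) - + suc m / 1) * 1/Mk
      ≡⟨ cong₂ (λ x y → (2^ℚ k * x - y) * 1/Mk) (M^-suc (2 ℕ.* k) m {{m*n≢0 2 k}}) (/1-homo-+ (+ 1) (+ m)) ⟩
    (2^ℚ k * (G m + p) - (1ℚ + + m / 1)) * 1/Mk
      -- The growth of `G` contributes `a :* p` and that of the counting term contributes `u`, which
      -- stands for 1.
      ≡⟨ solve 6 (λ a x p u v r → (a :* (x :+ p) :- (u :+ v)) :* r := (a :* x :- v) :* r :+ (a :* p :- u) :* r)
           refl (2^ℚ k) (G m) p 1ℚ (+ m / 1) 1/Mk ⟩
    S m + (2^ℚ k * p - 1ℚ) * 1/Mk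
      -- The numerator is M_{k(2m+1)}, and `odd-term m` unfolds to its quotient by M_k.
      ≡⟨ cong (λ x → S m + x * 1/Mk) (Mℚ-odd-multiple k m) ⟨
    S m + odd-term m ∎
    where
    p : ℚ
    p = 2^ℚ (2 ℕ.* k ℕ.* m)
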